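{- Let $n\ge 1$ and let $\sigma=s_1\cdots s_n\in S_n$ be a permutation. Then $$|\varphi^{ -1}(\sigma)|=\prod_{i=1}^n \ell(i;\sigma),$$ where $\ell(i;\sigma)$ is the length of the longest subsequence $s_j\cdots s_i$ of consecutive entries of $\sigma$ such that $s_t\le s_i$ for all $j\le t\le i$.
   Context: Write $[n]=\{1,\dots,n\}$. A street has parking spots $1,\dots,n$ in order, and cars $c_1,\dots,c_n$ arrive in this order. Given $\alpha=(a_1,\dots,a_n)\in[n]^n$, car $c_i$ drives to its preferred spot $a_i$ and parks there if it is empty; otherwise it continues forward and parks in the first empty spot after $a_i$, if there is one (otherwise it fails to park). The tuple $\alpha$ is a parking function of length $n$ if all $n$ cars park; $PF_n$ is the set of parking functions of length $n$. $S_n$ is the symmetric group on $[n]$, with permutations in one-line notation. The map $\varphi:PF_n\to S_n$ sends $\alpha$ to $s_1s_2\cdots s_n$, where spot $i$ is occupied by car $c_{s_i}$ after all cars have parked. $\varphi^{ -1}(\sigma)\subseteq PF_n$ denotes the fiber. -}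

module Defs where

open import Data.Empty using (⊥)
open import Data.Fin.Base using (Fin; zero; suc; toℕ; punchOut; _≤_)
open import Data.Fin.Permutation
  using (Permutation′; permutation; _⟨$⟩ʳ_; _≈_)
open import Data.Fin.Properties
  using (_≟_; _≤?_; any?; all?; punchOut-injective; injective⇒≤)
open import Data.List.Base as List using ()
open import Data.List.Extrema.Nat using (max)
open import Data.Maybe.Base using (Maybe; just; nothing)
open import Data.Maybe.Properties using (just-injective)
open import Data.Nat.Base as ℕ using (ℕ; zero; suc; _∸_)
open import Data.Nat.ListAction using (product)
import Data.Nat.Properties as ℕ
open import Data.Product.Base using (Σ-syntax; ∃-syntax; _×_; _,_; proj₁; proj₂)
open import Data.Vec.Base using (Vec; []; _∷_; lookup; replicate)
open import Function.Base using (_∘_)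
open import Function.Bundles using (Inverse)
open import Function.Definitions using (Injective)
open import Level using (0ℓ)
open import Relation.Binary.Bundles using (Setoid)
import Relation.Binary.Construct.On as On
open import Relation.Binary.PropositionalEquality
  using (_≡_; refl; sym; trans; cong; subst; setoid)
open import Relation.Nullary.Decidable using (Dec; yes; no; _×-dec_; _→-dec_)
open import Relation.Nullary.Negation using (contradiction)

-- Cars, spots and values of a permutation are numbered from 0: the element
-- i of Fin n stands for the number toℕ i + 1 of [n].

-- m spots in order, each empty or holding a car from C.
Street : Set → ℕ → Set
Street C m = Vec (Maybe C) m

-- Car c with preferred spot a arrives; if every spot from a onwards is
-- taken, it fails to park and the street does not change.
park : ∀ {C m} → C → Fin m → Street C m → Street C m
park c (suc a) (x       ∷ xs)       = x ∷ park c a xs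
park c zero    (nothing ∷ xs)       = just c ∷ xs
park c zero    (just d  ∷ [])       = just d ∷ []
park c zero    (just d  ∷ (x ∷ xs)) = just d ∷ park c zero (x ∷ xs)

-- The street after all cars have arrived, car 0 first.
finalStreet : ∀ {n} → Vec (Fin n) n → Street (Fin n) n
finalStreet {n} α =
  List.foldl (λ s c → park c (lookup α c) s) (replicate n nothing) (List.allFin n)

Parks : ∀ {n} → Vec (Fin n) n → Fin n → Set
Parks α c = ∃[ i ] lookup (finalStreet α) i ≡ just c

IsParkingFunction : ∀ {n} → Vec (Fin n) n → Set
IsParkingFunction α = ∀ c → Parks α c

PF : ℕ → Set
PF n = Σ[ α ∈ Vec (Fin n) n ] IsParkingFunction α

injective⇒∃preimage : ∀ {n} (f : Fin n → Fin n) → Injective _≡_ _≡_ f →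
                      ∀ i → ∃[ c ] f c ≡ i
injective⇒∃preimage {suc n} f inj i with any? (λ c → f c ≟ i)
... | yes found = found
... | no  none  = contradiction (injective⇒≤ punched-injective) ℕ.1+n≰n
  where
  avoids : ∀ c → i ≡ f c → ⊥
  avoids c i≡fc = none (c , sym i≡fc)

  punched-injective : Injective _≡_ _≡_ (λ c → punchOut (avoids c))
  punched-injective {c} {d} eq =
    inj (punchOut-injective (avoids c) (avoids d) eq)

module _ {n : ℕ} (p : PF n) where

  private
    α : Vec (Fin n) n
    α = proj₁ p

    parks : IsParkingFunction α
    parks = proj₂ p

  spot : Fin n → Fin n
  spot c = proj₁ (parks c)

  spot-injective : Injective _≡_ _≡_ spot
  spot-injective {c} {d} eq = just-injective
    (trans (sym (proj₂ (parks c)))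
           (trans (cong (lookup (finalStreet α)) eq) (proj₂ (parks d))))

  occupied : ∀ i → ∃[ c ] lookup (finalStreet α) i ≡ just c
  occupied i with c , eq ← injective⇒∃preimage spot spot-injective i =
    c , subst (λ j → lookup (finalStreet α) j ≡ just c) eq (proj₂ (parks c))

  occupant : Fin n → Fin n
  occupant i = proj₁ (occupied i)

  occupant-spot : ∀ c → occupant (spot c) ≡ c
  occupant-spot c = just-injective
    (trans (sym (proj₂ (occupied (spot c)))) (proj₂ (parks c)))

  spot-occupant : ∀ i → spot (occupant i) ≡ i
  spot-occupant i with c , eq ← injective⇒∃preimage spot spot-injective i =
    eq

  -- φ p ⟨$⟩ʳ i is the car standing on spot i of the final street.
  φ : Permutation′ n
  φ = permutation occupant spot occupant-spot spot-occupant

-- Elements of a fiber are compared as tuples in [n]ⁿ, ignoring the proofs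
-- attached to them.
φ⁻¹ : ∀ {n} → Permutation′ n → Setoid 0ℓ 0ℓ
φ⁻¹ {n} σ =
  On.setoid {B = Σ[ p ∈ PF n ] φ p ≈ σ} (setoid (Vec (Fin n) n)) (proj₁ ∘ proj₁)

HasCardinality : Setoid 0ℓ 0ℓ → ℕ → Set
HasCardinality S k = Inverse S (setoid (Fin k))

-- s_j ⋯ s_i is a nonempty block all of whose entries are at most s_i.
IsRun : ∀ {n} → Permutation′ n → Fin n → Fin n → Set
IsRun σ i j = j ≤ i × (∀ t → j ≤ t → t ≤ i → (σ ⟨$⟩ʳ t) ≤ (σ ⟨$⟩ʳ i))

isRun? : ∀ {n} (σ : Permutation′ n) (i j : Fin n) → Dec (IsRun σ i j)
isRun? σ i j = (j ≤? i) ×-dec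
  all? (λ t → (j ≤? t) →-dec ((t ≤? i) →-dec ((σ ⟨$⟩ʳ t) ≤? (σ ⟨$⟩ʳ i))))

-- The block s_j ⋯ s_i has i - j + 1 entries; j = i always qualifies, so the
-- default value 0 is never attained.
ℓ : ∀ {n} → Fin n → Permutation′ n → ℕ
ℓ {n} i σ = max 0
  (List.map (λ j → suc (toℕ i ∸ toℕ j)) (List.filter (isRun? σ i) (List.allFin n)))

∏ : ∀ {n} → (Fin n → ℕ) → ℕ
∏ f = product (List.tabulate f)

{-# OPTIONS --safe #-}

-- A tuple α lies in the fiber of σ exactly when, for every spot i, the spots
-- from the preference of car s_i up to i - 1 are taken by the time s_i arrives,
-- i.e. hold smaller cars: the preference must begin a run ending at i. The
-- beginnings of runs ending at i form an interval ending at i, of size ℓ(i;σ),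
-- and the choices for different spots are independent.
module Submission where

open import Defs
open import Data.Fin.Base using (Fin; zero; suc; toℕ; fromℕ<; combine; remQuot; _≤_; _<_)
open import Data.Fin.Permutation
  using (Permutation′; _⟨$⟩ʳ_; _⟨$⟩ˡ_; _≈_; inverseˡ; inverseʳ)
open import Data.Fin.Properties
  using (_≟_; <-cmp; toℕ<n; toℕ-injective; toℕ-fromℕ<; combine-remQuot; remQuot-combine)
open import Data.List.Base as List using (List; []; _∷_; allFin; foldl)
open import Data.List.Extrema.Nat using (argmax-sel; xs≤max)
open import Data.List.Membership.Propositional using (_∈_; _∉_)
open import Data.List.Membership.Propositional.Properties
  using (∈-allFin; ∈-filter⁺; ∈-filter⁻; ∈-map⁺; ∈-map⁻)
open import Data.List.Relation.Unary.All as All using (All; []; _∷_)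
open import Data.List.Relation.Unary.AllPairs using (AllPairs; []; _∷_)
open import Data.List.Relation.Unary.AllPairs.Properties using (tabulate⁺-<)
open import Data.List.Relation.Unary.Any using (here; there)
open import Data.Maybe.Base using (just; nothing)
open import Data.Maybe.Properties using (just-injective)
open import Data.Nat.Base as ℕ using (ℕ; zero; suc; _≥_; _∸_; z≤n; s≤s)
import Data.Nat.Properties as ℕ
open import Data.Product.Base using (∃-syntax; _×_; _,_; proj₁; proj₂)
open import Data.Sum.Base using (_⊎_; inj₁; inj₂)
open import Data.Vec.Base using (Vec; []; _∷_; lookup; replicate; tabulate; _[_]≔_)
open import Data.Vec.Properties
  using (lookup∘update; lookup∘update′; lookup-replicate; lookup∘tabulate; tabulate∘lookup; tabulate-cong)
open import Function.Base using (_∘_; id)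
open import Relation.Binary.Definitions using (tri<; tri≈; tri>)
open import Relation.Binary.PropositionalEquality
  using (_≡_; _≢_; refl; sym; trans; cong; cong₂; subst; module ≡-Reasoning)
open import Relation.Nullary.Decidable using (yes; no)
open import Relation.Nullary.Negation using (contradiction)

-- Mixed-radix coding of dependent choice functions

encode : ∀ {n} (f : Fin n → ℕ) → (∀ i → Fin (f i)) → Fin (∏ f)
encode {zero}  f g = zero
encode {suc n} f g = combine (g zero) (encode (f ∘ suc) (g ∘ suc))

decode : ∀ {n} (f : Fin n → ℕ) → Fin (∏ f) → ∀ i → Fin (f i)
decode {suc n} f m zero    = proj₁ (remQuot {f zero} (∏ (f ∘ suc)) m)
decode {suc n} f m (suc i) = decode (f ∘ suc) (proj₂ (remQuot {f zero} (∏ (f ∘ suc)) m)) i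

-- Serves in place of function extensionality: choice functions are only ever shown to agree
-- pointwise.
encode-cong : ∀ {n} (f : Fin n → ℕ) {g h : ∀ i → Fin (f i)} →
              (∀ i → g i ≡ h i) → encode f g ≡ encode f h
encode-cong {zero}  f g≗h = refl
encode-cong {suc n} f g≗h = cong₂ combine (g≗h zero) (encode-cong (f ∘ suc) (g≗h ∘ suc))

decode-encode : ∀ {n} (f : Fin n → ℕ) (g : ∀ i → Fin (f i)) → ∀ i → decode f (encode f g) i ≡ g i
decode-encode {suc n} f g zero    =
  cong proj₁ (remQuot-combine (g zero) (encode (f ∘ suc) (g ∘ suc)))
decode-encode {suc n} f g (suc i) = trans
  (cong (λ m → decode (f ∘ suc) (proj₂ m) i)
        (remQuot-combine (g zero) (encode (f ∘ suc) (g ∘ suc))))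
  (decode-encode (f ∘ suc) (g ∘ suc) i)

encode-decode : ∀ {n} (f : Fin n → ℕ) (m : Fin (∏ f)) → encode f (decode f m) ≡ m
encode-decode {zero}  f zero = refl
encode-decode {suc n} f m    = trans
  (cong (combine (decode f m zero))
        (encode-decode (f ∘ suc) (proj₂ (remQuot {f zero} (∏ (f ∘ suc)) m))))
  (combine-remQuot {f zero} (∏ (f ∘ suc)) m)

-- A single arrival and the cars still to come

-- Indexed by the resulting street, so that a match replaces `park c a s` by `s` or by an explicit
-- update, with the facts on empty and full spots at hand.
data Arrival {C m} (c : C) (a : Fin m) (s : Street C m) : Street C m → Set where
  parked : ∀ i → a ≤ i → lookup s i ≡ nothing →
           (∀ t → a ≤ t → t < i → lookup s t ≢ nothing) →
           Arrival c a s (s [ i ]≔ just c)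
  failed : (∀ t → a ≤ t → lookup s t ≢ nothing) → Arrival c a s s

arrival : ∀ {C m} (c : C) (a : Fin m) (s : Street C m) → Arrival c a s (park c a s)
arrival c zero (nothing ∷ xs)    = parked zero z≤n refl λ _ _ ()
arrival c zero (just d  ∷ [])    = failed λ { zero _ () }
arrival c zero (just d ∷ xs@(_ ∷ _)) with park c zero xs | arrival c zero xs
... | _ | parked i _ empty full =
      parked (suc i) z≤n empty λ { zero _ _ () ; (suc t) _ (s≤s t<i) → full t z≤n t<i }
... | _ | failed full = failed λ { zero _ () ; (suc t) _ → full t z≤n }
arrival c (suc a) (x ∷ xs) with park c a xs | arrival c a xs
... | _ | parked i a≤i empty full =
      parked (suc i) (s≤s a≤i) empty λ { (suc t) (s≤s a≤t) (s≤s t<i) → full t a≤t t<i }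
... | _ | failed full = failed λ { (suc t) (s≤s a≤t) → full t a≤t }

-- For a sorted list: `cs` is a final segment of the cars. A car outside it has therefore already
-- had its turn.
Upper : ∀ {n} → List (Fin n) → Set
Upper cs = ∀ d → d ∈ cs ⊎ All (d <_) cs

All-<⇒∉ : ∀ {n} {c : Fin n} {cs} → All (c <_) cs → c ∉ cs
All-<⇒∉ c<cs c∈cs = ℕ.<-irrefl refl (All.lookup c<cs c∈cs)

Upper-tail : ∀ {n} {c : Fin n} {cs} → All (c <_) cs → Upper (c ∷ cs) → Upper cs
Upper-tail c<cs upper d with upper d
... | inj₁ (here refl)  = inj₂ c<cs
... | inj₁ (there d∈cs) = inj₁ d∈cs
... | inj₂ (_ ∷ d<cs)   = inj₂ d<cs

-- Streets on which all arrivals so far agree with σ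

module _ {n : ℕ} (σ : Permutation′ n) where

  σ-injective : ∀ {i j} → σ ⟨$⟩ʳ i ≡ σ ⟨$⟩ʳ j → i ≡ j
  σ-injective eq = trans (sym (inverseˡ σ)) (trans (cong (σ ⟨$⟩ˡ_) eq) (inverseˡ σ))

  σ-surjective : ∀ c → ∃[ i ] σ ⟨$⟩ʳ i ≡ c
  σ-surjective c = σ ⟨$⟩ˡ c , inverseʳ σ

  -- Of the cars, those in cs have yet to arrive and those before them have
  -- parked where σ puts them.
  record Consistent (cs : List (Fin n)) (s : Street (Fin n) n) : Set where
    constructor consistent
    field
      at : ∀ i → (σ ⟨$⟩ʳ i ∈ cs × lookup s i ≡ nothing) ⊎
                 (All (σ ⟨$⟩ʳ i <_) cs × lookup s i ≡ just (σ ⟨$⟩ʳ i))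

  open Consistent

  Realises : Vec (Fin n) n → Set
  Realises α = ∀ i → lookup (finalStreet α) i ≡ just (σ ⟨$⟩ʳ i)

  StartsRuns : Vec (Fin n) n → Set
  StartsRuns α = ∀ i → IsRun σ i (lookup α (σ ⟨$⟩ʳ i))

  unparked-empty : ∀ {cs s} → Consistent cs s → ∀ i → σ ⟨$⟩ʳ i ∈ cs → lookup s i ≡ nothing
  unparked-empty con i σi∈cs with at con i
  ... | inj₁ (_ , empty) = empty
  ... | inj₂ (σi<cs , _) = contradiction σi∈cs (All-<⇒∉ σi<cs)

  smaller-parked : ∀ {c cs s} → Consistent (c ∷ cs) s → All (c <_) cs →
                   ∀ i → σ ⟨$⟩ʳ i < c → lookup s i ≢ nothing
  smaller-parked con c<cs i σi<c empty with at con i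
  ... | inj₁ (here refl , _)   = ℕ.<-irrefl refl σi<c
  ... | inj₁ (there σi∈cs , _) = ℕ.<-asym σi<c (All.lookup c<cs σi∈cs)
  ... | inj₂ (_ , full) with () ← trans (sym empty) full

  full⇒smaller : ∀ {c cs s} → Consistent (c ∷ cs) s → ∀ i → lookup s i ≢ nothing → σ ⟨$⟩ʳ i < c
  full⇒smaller con i full with at con i
  ... | inj₁ (_ , empty)        = contradiction empty full
  ... | inj₂ ((σi<c ∷ _) , _) = σi<c

  Consistent-park : ∀ {cs s} i → All (σ ⟨$⟩ʳ i <_) cs → Consistent ((σ ⟨$⟩ʳ i) ∷ cs) s →
                    Consistent cs (s [ i ]≔ just (σ ⟨$⟩ʳ i))
  at (Consistent-park {s = s} i c<cs con) t with t ≟ i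
  ... | yes refl = inj₂ (c<cs , lookup∘update i s _)
  ... | no t≢i with at con t
  ...   | inj₁ (here eq , _)          = contradiction (σ-injective eq) t≢i
  ...   | inj₁ (there σt∈cs , empty)  = inj₁ (σt∈cs , trans (lookup∘update′ t≢i s _) empty)
  ...   | inj₂ ((_ ∷ σt<cs) , full) = inj₂ (σt<cs , trans (lookup∘update′ t≢i s _) full)

  -- The later street only shows that the other parked cars precede `cs`; `Upper` adds that they
  -- precede `σ ⟨$⟩ʳ i` as well. The update hides what `s` had on spot i, so its emptiness is
  -- assumed separately.
  Consistent-unpark : ∀ {cs s} i → All (σ ⟨$⟩ʳ i <_) cs → Upper ((σ ⟨$⟩ʳ i) ∷ cs) →
                      lookup s i ≡ nothing → Consistent cs (s [ i ]≔ just (σ ⟨$⟩ʳ i)) →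
                      Consistent ((σ ⟨$⟩ʳ i) ∷ cs) s
  at (Consistent-unpark {s = s} i c<cs upper empty con) t with t ≟ i
  ... | yes refl = inj₁ (here refl , empty)
  ... | no t≢i with at con t | lookup∘update′ t≢i s (just (σ ⟨$⟩ʳ i))
  ...   | inj₁ (σt∈cs , e) | same = inj₁ (there σt∈cs , trans (sym same) e)
  ...   | inj₂ (σt<cs , f) | same with upper (σ ⟨$⟩ʳ t)
  ...     | inj₁ (here eq)      = contradiction (σ-injective eq) t≢i
  ...     | inj₁ (there σt∈cs)  = contradiction σt∈cs (All-<⇒∉ σt<cs)
  ...     | inj₂ σt<c∷cs        = inj₂ (σt<c∷cs , trans (sym same) f)

  -- Preferences that start runs are those whose final street is σ

  module _ (α : Vec (Fin n) n) where

    arrive : Street (Fin n) n → Fin n → Street (Fin n) n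
    arrive s c = park c (lookup α c) s

    -- By the run condition and injectivity of σ, the spots from the preference up to i - 1 belong
    -- to strictly smaller cars, which have parked already. Spot i is still empty, so it is the
    -- first empty one.
    park-run : ∀ {cs s} i → All (σ ⟨$⟩ʳ i <_) cs → Consistent ((σ ⟨$⟩ʳ i) ∷ cs) s →
               IsRun σ i (lookup α (σ ⟨$⟩ʳ i)) →
               arrive s (σ ⟨$⟩ʳ i) ≡ s [ i ]≔ just (σ ⟨$⟩ʳ i)
    park-run {s = s} i c<cs con (a≤i , run)
      with arrive s (σ ⟨$⟩ʳ i) | arrival (σ ⟨$⟩ʳ i) (lookup α (σ ⟨$⟩ʳ i)) s
    ... | _ | failed full = contradiction (unparked-empty con i (here refl)) (full i a≤i)
    ... | _ | parked j a≤j empty full with <-cmp i j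
    ...   | tri≈ _ refl _ = refl
    ...   | tri< i<j _ _ = contradiction (unparked-empty con i (here refl)) (full i a≤i i<j)
    ...   | tri> _ j≢i j<i = contradiction empty (smaller-parked con c<cs j σj<σi)
      where
      σj<σi : σ ⟨$⟩ʳ j < σ ⟨$⟩ʳ i
      σj<σi = ℕ.≤∧≢⇒< (run j a≤j (ℕ.<⇒≤ j<i))
                λ eq → ℕ.<⇒≢ j<i (cong toℕ (σ-injective (toℕ-injective eq)))

    runs⇒final : StartsRuns α → ∀ cs s → AllPairs _<_ cs → Consistent cs s →
                 ∀ i → lookup (foldl arrive s cs) i ≡ just (σ ⟨$⟩ʳ i)
    runs⇒final runs [] s [] con i with at con i
    ... | inj₂ (_ , full) = full
    runs⇒final runs (c ∷ cs) s (c<cs ∷ sorted) con with i , refl ← σ-surjective c =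
      runs⇒final runs cs _ sorted
        (subst (Consistent cs) (sym (park-run i c<cs con (runs i))) (Consistent-park i c<cs con))

    -- Maintains the invariant that no remaining car stands on the street yet; `final⇒runs` uses it
    -- to exclude a failed arrival.
    absent-arrive : ∀ c cs s → All (c <_) cs → (∀ i d → lookup s i ≡ just d → d ∉ c ∷ cs) →
                    ∀ i d → lookup (arrive s c) i ≡ just d → d ∉ cs
    absent-arrive c cs s c<cs absent i d eq
      with arrive s c | arrival c (lookup α c) s
    ... | _ | failed _ = absent i d eq ∘ there
    ... | _ | parked j _ _ _ with i ≟ j
    ...   | no i≢j = absent i d (trans (sym (lookup∘update′ i≢j s _)) eq) ∘ there
    ...   | yes refl with refl ← just-injective (trans (sym (lookup∘update i s _)) eq) =
            All-<⇒∉ c<cs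

    -- Induction from the end of the day: the street after an arrival
    -- determines where the car parked, hence also the street before it.
    final⇒runs : ∀ cs s → AllPairs _<_ cs → Upper cs →
                 (∀ i d → lookup s i ≡ just d → d ∉ cs) →
                 (∀ i → lookup (foldl arrive s cs) i ≡ just (σ ⟨$⟩ʳ i)) →
                 Consistent cs s ×
                 (∀ i → σ ⟨$⟩ʳ i ∈ cs → IsRun σ i (lookup α (σ ⟨$⟩ʳ i)))
    final⇒runs [] s [] upper absent final = consistent (λ i → inj₂ ([] , final i)) , λ _ ()
    final⇒runs (c ∷ cs) s (c<cs ∷ sorted) upper absent final
      with i , refl ← σ-surjective c
      -- The recursive call precedes the match on `arrival`, so that the match also refines the
      -- street in the type of `con`.
      with con , runs ← final⇒runs cs (arrive s c) sorted (Upper-tail c<cs upper)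
                                   (absent-arrive c cs s c<cs absent) final
      with arrive s c | arrival c (lookup α c) s
    -- Had the car failed, the unchanged street would already hold it on spot i, against `absent`.
    ... | _ | failed _ with at con i
    ...   | inj₁ (c∈cs , _) = contradiction c∈cs (All-<⇒∉ c<cs)
    ...   | inj₂ (_ , full) = contradiction (here refl) (absent i _ full)
    final⇒runs (c ∷ cs) s (c<cs ∷ sorted) upper absent final
        | _ | parked j a≤j empty full with at con j
    ... | inj₁ (_ , empty′) with () ← trans (sym empty′) (lookup∘update j s _)
    -- Spot j holds the car that just arrived and also the car σ assigns to j, so j = i.
    ... | inj₂ (_ , full′)
      with refl ← σ-injective (just-injective (trans (sym full′) (lookup∘update j s _))) =
      before , runs′
      where
      before : Consistent ((σ ⟨$⟩ʳ i) ∷ cs) s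
      before = Consistent-unpark i c<cs upper empty con

      run : IsRun σ i (lookup α (σ ⟨$⟩ʳ i))
      run = a≤j , λ t a≤t t≤i → helper t a≤t (ℕ.m≤n⇒m<n∨m≡n t≤i)
        where
        helper : ∀ t → lookup α (σ ⟨$⟩ʳ i) ≤ t → t < i ⊎ toℕ t ≡ toℕ i →
                 σ ⟨$⟩ʳ t ≤ σ ⟨$⟩ʳ i
        helper t a≤t (inj₁ t<i) = ℕ.<⇒≤ (full⇒smaller before t (full t a≤t t<i))
        helper t a≤t (inj₂ t≡i) = ℕ.≤-reflexive (cong (toℕ ∘ (σ ⟨$⟩ʳ_)) (toℕ-injective t≡i))

      runs′ : ∀ k → σ ⟨$⟩ʳ k ∈ (σ ⟨$⟩ʳ i) ∷ cs → IsRun σ k (lookup α (σ ⟨$⟩ʳ k))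
      runs′ k (here eq) with refl ← σ-injective eq = run
      runs′ k (there σk∈cs) = runs k σk∈cs

    allFin-sorted : AllPairs {A = Fin n} _<_ (allFin n)
    allFin-sorted = tabulate⁺-< id

    startsRuns⇒realises : StartsRuns α → Realises α
    startsRuns⇒realises runs = runs⇒final runs (allFin n) _ allFin-sorted
      (consistent λ i → inj₁ (∈-allFin _ , lookup-replicate i nothing))

    realises⇒startsRuns : Realises α → StartsRuns α
    realises⇒startsRuns final i =
      proj₂ (final⇒runs (allFin n) _ allFin-sorted (inj₁ ∘ ∈-allFin) absent final) i (∈-allFin _)
      where
      absent : ∀ i d → lookup (replicate n nothing) i ≡ just d → d ∉ allFin n
      absent i d eq with () ← trans (sym (lookup-replicate i nothing)) eq

    realises⇒fiber : Realises α → ∃[ pf ] φ (α , pf) ≈ σ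
    realises⇒fiber final = pf , λ i →
      just-injective (trans (sym (proj₂ (occupied (α , pf) i))) (final i))
      where
      pf : IsParkingFunction α
      pf c = σ ⟨$⟩ˡ c , trans (final _) (cong just (inverseʳ σ))

  fiber⇒realises : ∀ p → φ p ≈ σ → Realises (proj₁ p)
  fiber⇒realises p φp≈σ i = trans (proj₂ (occupied p i)) (cong just (φp≈σ i))

  -- The beginnings of runs ending at i form an interval

  run⇒<ℓ : ∀ {i j} → IsRun σ i j → toℕ i ∸ toℕ j ℕ.< ℓ i σ
  run⇒<ℓ {i} run = All.lookup (xs≤max 0 _)
    (∈-map⁺ (λ j → suc (toℕ i ∸ toℕ j)) (∈-filter⁺ (isRun? σ i) (∈-allFin _) run))

  -- The maximum is attained, so j can be taken as the beginning of a longest run.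
  <ℓ⇒run : ∀ {i k} → k ℕ.< ℓ i σ → ∃[ j ] IsRun σ i j × k ℕ.≤ toℕ i ∸ toℕ j
  <ℓ⇒run {i} {k} k<ℓ with argmax-sel id 0
    (List.map (λ j → suc (toℕ i ∸ toℕ j)) (List.filter (isRun? σ i) (allFin n)))
  -- The default value 0 of `max` would leave no room for k.
  ... | inj₁ ℓ≡0 = contradiction (subst (k ℕ.<_) ℓ≡0 k<ℓ) λ ()
  ... | inj₂ ℓ∈  with j , j∈ , eq ← ∈-map⁻ _ ℓ∈ =
    j , proj₂ (∈-filter⁻ (isRun? σ i) {xs = allFin n} j∈) , ℕ.s≤s⁻¹ (subst (k ℕ.<_) eq k<ℓ)

  <ℓ⇒≤ : ∀ {i k} → k ℕ.< ℓ i σ → k ℕ.≤ toℕ i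
  <ℓ⇒≤ {i} k<ℓ with j , _ , k≤i∸j ← <ℓ⇒run k<ℓ = ℕ.≤-trans k≤i∸j (ℕ.m∸n≤m (toℕ i) (toℕ j))

  -- The subtraction truncates at the first spot; by `<ℓ⇒≤` this never happens for k below `ℓ i σ`.
  back : Fin n → ℕ → Fin n
  back i k = fromℕ< (ℕ.≤-<-trans (ℕ.m∸n≤m (toℕ i) k) (toℕ<n i))

  toℕ-back : ∀ i k → toℕ (back i k) ≡ toℕ i ∸ k
  toℕ-back i k = toℕ-fromℕ< _

  -- A run stays a run when shortened from the left, and a longest one begins no later than
  -- `back i k`.
  back-run : ∀ {i k} → k ℕ.< ℓ i σ → IsRun σ i (back i k)
  back-run {i} {k} k<ℓ with j , (j≤i , run) , k≤i∸j ← <ℓ⇒run k<ℓ =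
    subst (ℕ._≤ toℕ i) (sym (toℕ-back i k)) (ℕ.m∸n≤m (toℕ i) k) ,
    λ t b≤t → run t (ℕ.≤-trans j≤b b≤t)
    where
    j≤b : j ≤ back i k
    j≤b = subst (toℕ j ℕ.≤_) (sym (toℕ-back i k))
            (subst (ℕ._≤ toℕ i ∸ k) (ℕ.m∸[m∸n]≡n j≤i) (ℕ.∸-monoʳ-≤ (toℕ i) k≤i∸j))

  -- Preferences coded by their distances to the spots

  offsets : ∀ α → StartsRuns α → ∀ i → Fin (ℓ i σ)
  offsets α runs i = fromℕ< (run⇒<ℓ (runs i))

  -- The right-hand side does not mention `runs`: the offset depends on the tuple alone, as equality
  -- in the fiber demands.
  toℕ-offsets : ∀ α (runs : StartsRuns α) i →
                toℕ (offsets α runs i) ≡ toℕ i ∸ toℕ (lookup α (σ ⟨$⟩ʳ i))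
  toℕ-offsets α runs i = toℕ-fromℕ< (run⇒<ℓ (runs i))

  preferences : (∀ i → Fin (ℓ i σ)) → Vec (Fin n) n
  preferences g = tabulate λ c → back (σ ⟨$⟩ˡ c) (toℕ (g (σ ⟨$⟩ˡ c)))

  lookup-preferences : ∀ g i → lookup (preferences g) (σ ⟨$⟩ʳ i) ≡ back i (toℕ (g i))
  lookup-preferences g i = trans (lookup∘tabulate _ (σ ⟨$⟩ʳ i))
    (cong (λ j → back j (toℕ (g j))) (inverseˡ σ))

  preferences-startsRuns : ∀ g → StartsRuns (preferences g)
  preferences-startsRuns g i =
    subst (IsRun σ i) (sym (lookup-preferences g i)) (back-run (toℕ<n (g i)))

  -- Allows any α equal to `preferences g` with any proof `runs`, since the inverse law for setoids
  -- provides an arbitrary element of the fiber with such an equation.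
  offsets-preferences : ∀ g α (runs : StartsRuns α) → α ≡ preferences g →
                        ∀ i → offsets α runs i ≡ g i
  offsets-preferences g α runs refl i = toℕ-injective (begin
    toℕ (offsets α runs i)                                   ≡⟨ toℕ-offsets α runs i ⟩
    toℕ i ∸ toℕ (lookup (preferences g) (σ ⟨$⟩ʳ i))        ≡⟨ cong (λ j → toℕ i ∸ toℕ j) (lookup-preferences g i) ⟩
    toℕ i ∸ toℕ (back i (toℕ (g i)))                       ≡⟨ cong (toℕ i ∸_) (toℕ-back i (toℕ (g i))) ⟩
    toℕ i ∸ (toℕ i ∸ toℕ (g i))                            ≡⟨ ℕ.m∸[m∸n]≡n (<ℓ⇒≤ (toℕ<n (g i))) ⟩
    toℕ (g i)                                              ∎)
    where open ≡-Reasoning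

  preferences-offsets : ∀ g α (runs : StartsRuns α) → (∀ i → g i ≡ offsets α runs i) →
                        preferences g ≡ α
  preferences-offsets g α runs g≗ = trans (tabulate-cong pointwise) (tabulate∘lookup α)
    where
    open ≡-Reasoning

    pointwise : ∀ c → back (σ ⟨$⟩ˡ c) (toℕ (g (σ ⟨$⟩ˡ c))) ≡ lookup α c
    pointwise c with i , refl ← σ-surjective c = toℕ-injective (begin
      toℕ (back (σ ⟨$⟩ˡ (σ ⟨$⟩ʳ i)) (toℕ (g (σ ⟨$⟩ˡ (σ ⟨$⟩ʳ i)))))
        ≡⟨ cong (λ j → toℕ (back j (toℕ (g j)))) (inverseˡ σ) ⟩
      toℕ (back i (toℕ (g i)))
        ≡⟨ toℕ-back i (toℕ (g i)) ⟩
      toℕ i ∸ toℕ (g i)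
        ≡⟨ cong (toℕ i ∸_) (trans (cong toℕ (g≗ i)) (toℕ-offsets α runs i)) ⟩
      toℕ i ∸ (toℕ i ∸ toℕ (lookup α (σ ⟨$⟩ʳ i)))
        -- Subtracting twice is harmless because a run ending at i begins at or before i.
        ≡⟨ ℕ.m∸[m∸n]≡n (proj₁ (runs i)) ⟩
      toℕ (lookup α (σ ⟨$⟩ʳ i)) ∎)

proposition3p3 : (n : ℕ) → n ≥ 1 → (σ : Permutation′ n) → HasCardinality (φ⁻¹ σ) (∏ (λ i → ℓ i σ))
proposition3p3 n _ σ = record
  { to        = λ x → encode L (offsets σ (prefs x) (runs x))
  ; from      = λ m → (preferences σ (decode L m) , proj₁ (fiber m)) , proj₂ (fiber m)
  ; to-cong   = λ {x} {y} x≈y → encode-cong L λ i → toℕ-injective (begin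
      toℕ (offsets σ (prefs x) (runs x) i)         ≡⟨ toℕ-offsets σ (prefs x) (runs x) i ⟩
      toℕ i ∸ toℕ (lookup (prefs x) (σ ⟨$⟩ʳ i))    ≡⟨ cong (λ α → toℕ i ∸ toℕ (lookup α (σ ⟨$⟩ʳ i))) x≈y ⟩
      toℕ i ∸ toℕ (lookup (prefs y) (σ ⟨$⟩ʳ i))    ≡⟨ toℕ-offsets σ (prefs y) (runs y) i ⟨
      toℕ (offsets σ (prefs y) (runs y) i)         ∎)
  ; from-cong = cong (preferences σ ∘ decode L)
  ; inverse   =
      (λ {m} {x} x≈ → trans
        (encode-cong L (offsets-preferences σ (decode L m) (prefs x) (runs x) x≈))
        (encode-decode L m)) ,
      (λ { {x} refl → preferences-offsets σ _ (prefs x) (runs x)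
                        (decode-encode L (offsets σ (prefs x) (runs x))) })
  }
  where
  open ≡-Reasoning

  L : Fin n → ℕ
  L i = ℓ i σ

  Fiber : Set
  Fiber = ∃[ p ] φ p ≈ σ

  prefs : Fiber → Vec (Fin n) n
  prefs ((α , _) , _) = α

  runs : ∀ x → StartsRuns σ (prefs x)
  runs (p , φp≈σ) = realises⇒startsRuns σ (proj₁ p) (fiber⇒realises σ p φp≈σ)

  fiber : ∀ m → ∃[ pf ] φ (preferences σ (decode L m) , pf) ≈ σ
  fiber m = realises⇒fiber σ α (startsRuns⇒realises σ α (preferences-startsRuns σ (decode L m)))
    where
    α : Vec (Fin n) n
    α = preferences σ (decode L m)
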